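{- Let $\mathbf v\in\mathbb Z^4$ satisfy $Q_{\mathcal D}(\mathbf v)=-4$, and let $\mathcal C$ be the set of all integers occurring as a coordinate of some element of the orbit $\mathcal A[\mathbf v]$ (the curvatures of the corresponding integral spherical Apollonian packing). Then the set of residues modulo $12$ of elements of $\mathcal C$ omits exactly three congruence classes modulo $12$.
   Context: $Q_{\mathcal D}(a,b,c,d)=2(a^2+b^2+c^2+d^2)-(a+b+c+d)^2$. $\mathbf S_i$ ($i=1,\dots,4$) is the $4\times4$ integer matrix replacing the $i$-th coordinate $a_i$ of a column vector by $2\sum_{j\ne i}a_j-a_i$, other coordinates fixed; the Apollonian group $\mathcal A$ is the subgroup of $GL(4,\mathbb Z)$ they generate, and $\mathcal A[\mathbf v]=\{\mathbf U\mathbf v:\mathbf U\in\mathcal A\}$. -}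

module Defs where

open import Data.Bool.Base using (if_then_else_)
open import Data.Fin.Base using (Fin; zero; suc; toℕ)
open import Data.Fin.Properties using (_≟_)
open import Data.Integer.Base using (ℤ; +_; _+_; _*_; _-_; 0ℤ; 1ℤ; -1ℤ)
open import Data.Integer.Divisibility.Signed using (_∣_)
open import Data.Nat.Base using (ℕ)
open import Data.Product.Base using (_×_; ∃-syntax)
open import Data.Vec.Base using (Vec; foldr′; lookup; map; tabulate; transpose; zipWith)
open import Relation.Binary.PropositionalEquality using (_≡_; refl)
open import Relation.Nullary.Decidable.Core using (does)
open import Relation.Unary using (Pred)
open import Level using (0ℓ)

∑ : ∀ {n} → Vec ℤ n → ℤ
∑ = foldr′ _+_ 0ℤ

_·_ : ∀ {n} → Vec ℤ n → Vec ℤ n → ℤ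
u · v = ∑ (zipWith _*_ u v)

Q𝒟 : Vec ℤ 4 → ℤ
Q𝒟 v = + 2 * (v · v) - ∑ v * ∑ v

-- Matrices are vectors of rows.
Matrix : ℕ → Set
Matrix n = Vec (Vec ℤ n) n

infixl 7 _⊛_
infixr 8 _∙_

_∙_ : ∀ {n} → Matrix n → Vec ℤ n → Vec ℤ n
M ∙ v = map (_· v) M

_⊛_ : ∀ {n} → Matrix n → Matrix n → Matrix n
M ⊛ N = map (λ row → map (row ·_) (transpose N)) M

I : ∀ {n} → Matrix n
I = tabulate λ j → tabulate λ k → if does (j ≟ k) then 1ℤ else 0ℤ

IsInverse : ∀ {n} → Matrix n → Matrix n → Set
IsInverse U V = (U ⊛ V ≡ I) × (V ⊛ U ≡ I)

-- Row i has -1 in column i and 2 elsewhere; the other rows are those of I.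
S : Fin 4 → Matrix 4
S i = tabulate λ j → tabulate λ k →
  if does (j ≟ i)
  then (if does (k ≟ i) then -1ℤ else + 2)
  else (if does (j ≟ k) then 1ℤ else 0ℤ)

S-involutive : ∀ i → S i ⊛ S i ≡ I
S-involutive zero                   = refl
S-involutive (suc zero)             = refl
S-involutive (suc (suc zero))       = refl
S-involutive (suc (suc (suc zero))) = refl

-- The least subgroup of GL(4,ℤ) containing every S i. All members are
-- invertible because the generators are (S-involutive).
data 𝒜 : Pred (Matrix 4) 0ℓ where
  gen : ∀ i → 𝒜 (S i)
  one : 𝒜 I
  mul : ∀ {U V} → 𝒜 U → 𝒜 V → 𝒜 (U ⊛ V)
  inv : ∀ {U V} → 𝒜 U → IsInverse U V → 𝒜 V

𝒜[_] : Vec ℤ 4 → Pred (Vec ℤ 4) 0ℓ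
𝒜[ v ] w = ∃[ U ] (𝒜 U × w ≡ U ∙ v)

Curvature : Vec ℤ 4 → Pred ℤ 0ℓ
Curvature v c = ∃[ w ] (𝒜[ v ] w × ∃[ i ] lookup w i ≡ c)

-- Congruence classes modulo m are represented by Fin m.
ResidueOf : ∀ m → Pred ℤ 0ℓ → Pred (Fin m) 0ℓ
ResidueOf m C r = ∃[ c ] (C c × + m ∣ c - + toℕ r)

{-# OPTIONS --safe #-}
-- Put σ = a + b + c + d. Since Q𝒟 (a, b, c, d) = -4 is even, σ is even. The
-- generator S i sends aᵢ to 2σ - 3aᵢ, so modulo 4 it fixes every coordinate:
-- the orbit has constant residues modulo 4. Reading the equation modulo 16
-- shows that these residues form exactly three of the four classes modulo 4.
-- Modulo 3, two generators suffice to move any coordinate to any residue. By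
-- the Chinese remainder theorem the curvatures fill exactly the classes modulo
-- 12 that lie over three classes modulo 4, and 3 ⋅ (4 - 3) = 3 are omitted.
module Submission where

open import Defs
open import Data.Bool.Base using (true)
open import Data.Fin.Base using (Fin; toℕ; fromℕ<)
open import Data.Fin.Properties using (all?; any?; toℕ-fromℕ<)
open import Data.Fin.Subset using (Subset; _∈_; ∁; ∣_∣)
open import Data.Integer.Base using (ℤ; +_; -_; _+_; _*_; _-_; 0ℤ; 1ℤ; _%ℕ_; _/ℕ_)
open import Data.Integer.DivMod using (n%ℕd<d; a≡a%ℕn+[a/ℕn]*n)
open import Data.Integer.Divisibility.Signed using (_∣_; divides; _∣?_; ∣-trans)
open import Data.Integer.Properties using (*-zeroˡ; *-zeroʳ)
open import Data.Integer.Tactic.RingSolver using (solve; solve-∀)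
import Data.List.Base as List
open import Data.Nat.Base using (zero; suc; NonZero)
import Data.Nat.Properties as ℕ
open import Data.Product.Base using (_×_; _,_; proj₁; proj₂; Σ-syntax; ∃-syntax)
open import Data.Vec.Base using (Vec; []; _∷_; lookup; map; replicate; tabulate; transpose)
import Data.Vec.Base as Vec
open import Data.Vec.Properties using (lookup⇒[]=; []=⇒lookup; lookup∘tabulate; map-cong; map-∘)
open import Data.Vec.Relation.Binary.Pointwise.Inductive as Pointwise using (Pointwise; []; _∷_)
open import Function.Base using (_∘_)
open import Function.Bundles using (_⇔_; mk⇔; module Equivalence)
open import Relation.Binary.Construct.Closure.ReflexiveTransitive using (Star; ε; _◅_; _◅◅_; reverse)
open import Relation.Binary.PropositionalEquality
  using (_≡_; refl; sym; trans; cong; cong₂; subst; module ≡-Reasoning)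
open import Relation.Nullary.Decidable using (Dec; yes; does; dec-true; map′; toWitness; _→-dec_; _×-dec_)

open Equivalence using (to; from)

-- Congruences

infix 4 _≈_[mod_] _≋_[mod_]

-- A record rather than a bare divisibility, so that `a` and `b` can be recovered by unification;
-- from `a - b` alone they cannot.
record _≈_[mod_] (a b m : ℤ) : Set where
  constructor mod
  field difference : m ∣ a - b

open _≈_[mod_] using (difference)

_≈?_[mod_] : ∀ a b m → Dec (a ≈ b [mod m ])
a ≈? b [mod m ] = map′ mod difference (m ∣? (a - b))

≈-refl : ∀ {m a} → a ≈ a [mod m ]
≈-refl {m} {a} = mod (divides 0ℤ (solve (a List.∷ m List.∷ List.[])))

≈-sym : ∀ {m a b} → a ≈ b [mod m ] → b ≈ a [mod m ]
≈-sym {m} {a} {b} (mod (divides q eq)) = mod (divides (- q) (begin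
  b - a      ≡⟨ solve (a List.∷ b List.∷ List.[]) ⟩
  - (a - b)  ≡⟨ cong -_ eq ⟩
  - (q * m)  ≡⟨ solve (q List.∷ m List.∷ List.[]) ⟩
  - q * m    ∎))
  where open ≡-Reasoning

≈-flip-≡ : ∀ {m a b c} → a ≡ c → a ≈ b [mod m ] → b ≈ c [mod m ]
≈-flip-≡ refl = ≈-sym

≈-trans : ∀ {m a b c} → a ≈ b [mod m ] → b ≈ c [mod m ] → a ≈ c [mod m ]
≈-trans {m} {a} {b} {c} (mod (divides p p-eq)) (mod (divides q q-eq)) = mod (divides (p + q) (begin
  a - c              ≡⟨ solve (a List.∷ b List.∷ c List.∷ List.[]) ⟩
  (a - b) + (b - c)  ≡⟨ cong₂ _+_ p-eq q-eq ⟩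
  p * m + q * m      ≡⟨ solve (p List.∷ q List.∷ m List.∷ List.[]) ⟩
  (p + q) * m        ∎))
  where open ≡-Reasoning

≈-coarsen : ∀ {m n a b} → m ∣ n → a ≈ b [mod n ] → a ≈ b [mod m ]
≈-coarsen m∣n (mod n∣a-b) = mod (∣-trans m∣n n∣a-b)

+-cong : ∀ {m a b c d} → a ≈ b [mod m ] → c ≈ d [mod m ] → a + c ≈ b + d [mod m ]
+-cong {m} {a} {b} {c} {d} (mod (divides p p-eq)) (mod (divides q q-eq)) = mod (divides (p + q) (begin
  a + c - (b + d)    ≡⟨ solve (a List.∷ b List.∷ c List.∷ d List.∷ List.[]) ⟩
  (a - b) + (c - d)  ≡⟨ cong₂ _+_ p-eq q-eq ⟩
  p * m + q * m      ≡⟨ solve (p List.∷ q List.∷ m List.∷ List.[]) ⟩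
  (p + q) * m        ∎))
  where open ≡-Reasoning

*-cong : ∀ {m a b c d} → a ≈ b [mod m ] → c ≈ d [mod m ] → a * c ≈ b * d [mod m ]
*-cong {m} {a} {b} {c} {d} (mod (divides p p-eq)) (mod (divides q q-eq)) = mod (divides (p * c + b * q) (begin
  a * c - b * d                ≡⟨ solve (a List.∷ b List.∷ c List.∷ d List.∷ List.[]) ⟩
  (a - b) * c + b * (c - d)    ≡⟨ cong₂ (λ x y → x * c + b * y) p-eq q-eq ⟩
  p * m * c + b * (q * m)      ≡⟨ solve (p List.∷ q List.∷ b List.∷ c List.∷ m List.∷ List.[]) ⟩
  (p * c + b * q) * m          ∎))
  where open ≡-Reasoning

*-congˡ : ∀ {m} k {a b} → a ≈ b [mod m ] → k * a ≈ k * b [mod m ]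
*-congˡ k = *-cong (≈-refl {a = k})

neg-cong : ∀ {m a b} → a ≈ b [mod m ] → - a ≈ - b [mod m ]
neg-cong {m} {a} {b} (mod (divides q eq)) = mod (divides (- q) (begin
  - a - - b  ≡⟨ solve (a List.∷ b List.∷ List.[]) ⟩
  - (a - b)  ≡⟨ cong -_ eq ⟩
  - (q * m)  ≡⟨ solve (q List.∷ m List.∷ List.[]) ⟩
  - q * m    ∎))
  where open ≡-Reasoning

-- Doubling the difference doubles the modulus too; this lifts the sum of squares in `Q𝒟` from
-- modulus 8 to 16.
double-cong : ∀ {m a b} → a ≈ b [mod m ] → + 2 * a ≈ + 2 * b [mod + 2 * m ]
double-cong {m} {a} {b} (mod (divides q eq)) = mod (divides q (begin
  + 2 * a - + 2 * b  ≡⟨ solve (a List.∷ b List.∷ List.[]) ⟩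
  + 2 * (a - b)      ≡⟨ cong (+ 2 *_) eq ⟩
  + 2 * (q * m)      ≡⟨ solve (q List.∷ m List.∷ List.[]) ⟩
  q * (+ 2 * m)      ∎))
  where open ≡-Reasoning

-- With a - b = 4q the difference of squares is 4q(4q + 2b), whose second factor is even.
square-cong-8 : ∀ {a b} → a ≈ b [mod + 4 ] → a * a ≈ b * b [mod + 8 ]
square-cong-8 {a} {b} (mod (divides q eq)) = mod (divides (q * (+ 2 * q + b)) (begin
  a * a - b * b                      ≡⟨ solve (a List.∷ b List.∷ List.[]) ⟩
  (a - b) * ((a - b) + + 2 * b)      ≡⟨ cong (λ x → x * (x + + 2 * b)) eq ⟩
  q * + 4 * (q * + 4 + + 2 * b)      ≡⟨ solve (q List.∷ b List.∷ List.[]) ⟩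
  q * (+ 2 * q + b) * + 8            ∎))
  where open ≡-Reasoning

-- For b = 2t the factor 4q + 2b becomes a multiple of 4, which gains one more power of two.
even-square-cong-16 : ∀ {a b} → + 2 ∣ b → a ≈ b [mod + 4 ] → a * a ≈ b * b [mod + 16 ]
even-square-cong-16 {a} {b} (divides t b≡2t) (mod (divides q eq)) = mod (divides (q * (q + t)) (begin
  a * a - b * b                              ≡⟨ solve (a List.∷ b List.∷ List.[]) ⟩
  (a - b) * ((a - b) + + 2 * b)              ≡⟨ cong₂ (λ x y → x * (x + + 2 * y)) eq b≡2t ⟩
  q * + 4 * (q * + 4 + + 2 * (t * + 2))      ≡⟨ solve (q List.∷ t List.∷ List.[]) ⟩
  q * (q + t) * + 16                         ∎))
  where open ≡-Reasoning

-- Rests on 1 = 4 - 3, applied to `a - b`.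
≈-chinese-12 : ∀ {a b} → a ≈ b [mod + 3 ] → a ≈ b [mod + 4 ] → a ≈ b [mod + 12 ]
≈-chinese-12 {a} {b} (mod (divides p p-eq)) (mod (divides q q-eq)) = mod (divides (p - q) (begin
  a - b                                  ≡⟨ solve (a List.∷ b List.∷ List.[]) ⟩
  + 4 * (a - b) - + 3 * (a - b)          ≡⟨ cong₂ (λ x y → + 4 * x - + 3 * y) p-eq q-eq ⟩
  + 4 * (p * + 3) - + 3 * (q * + 4)      ≡⟨ solve (p List.∷ q List.∷ List.[]) ⟩
  (p - q) * + 12                         ∎))
  where open ≡-Reasoning

-- Congruent vectors and values of the quadratic form

_≋_[mod_] : ∀ {n} → Vec ℤ n → Vec ℤ n → ℤ → Set
u ≋ v [mod m ] = Pointwise (λ a b → a ≈ b [mod m ]) u v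

∑-cong : ∀ {m n} {u v : Vec ℤ n} → u ≋ v [mod m ] → ∑ u ≈ ∑ v [mod m ]
∑-cong []       = ≈-refl
∑-cong (p ∷ ps) = +-cong p (∑-cong ps)

·-congˡ : ∀ {m n} (r : Vec ℤ n) {u v} → u ≋ v [mod m ] → r · u ≈ r · v [mod m ]
·-congˡ []      []       = ≈-refl
·-congˡ (x ∷ r) (p ∷ ps) = +-cong (*-congˡ x p) (·-congˡ r ps)

∙-cong : ∀ {m k n} (M : Vec (Vec ℤ n) k) {u v} → u ≋ v [mod m ] → map (_· u) M ≋ map (_· v) M [mod m ]
∙-cong []      ps = []
∙-cong (r ∷ M) ps = ·-congˡ r ps ∷ ∙-cong M ps

·-square-cong : ∀ {m m′ n} → (∀ {a b} → a ≈ b [mod m ] → a * a ≈ b * b [mod m′ ]) →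
  {u v : Vec ℤ n} → u ≋ v [mod m ] → u · u ≈ v · v [mod m′ ]
·-square-cong sq []       = ≈-refl
·-square-cong sq (p ∷ ps) = +-cong (sq p) (·-square-cong sq ps)

Q𝒟-cong : ∀ {m} {u v : Vec ℤ 4} → u ≋ v [mod m ] → Q𝒟 u ≈ Q𝒟 v [mod m ]
Q𝒟-cong ps = +-cong
  (*-congˡ (+ 2) (·-square-cong (λ p → *-cong p p) ps))
  (neg-cong (*-cong (∑-cong ps) (∑-cong ps)))

-- While the parity of the coordinate sum is unknown, the square of that sum limits the modulus to
-- 8.
Q𝒟-cong-8 : {u v : Vec ℤ 4} → u ≋ v [mod + 4 ] → Q𝒟 u ≈ Q𝒟 v [mod + 8 ]
Q𝒟-cong-8 ps = +-cong
  (*-congˡ (+ 2) (·-square-cong square-cong-8 ps))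
  (neg-cong (square-cong-8 (∑-cong ps)))

Q𝒟-cong-16 : {u v : Vec ℤ 4} → + 2 ∣ ∑ v → u ≋ v [mod + 4 ] → Q𝒟 u ≈ Q𝒟 v [mod + 16 ]
Q𝒟-cong-16 2∣∑ ps = +-cong
  (double-cong (·-square-cong square-cong-8 ps))
  (neg-cong (even-square-cong-16 2∣∑ (∑-cong ps)))

⌈_⌉ : ∀ {m n} → Vec (Fin m) n → Vec ℤ n
⌈_⌉ = map (+_ ∘ toℕ)

residue : ∀ m .{{_ : NonZero m}} → ℤ → Fin m
residue m a = fromℕ< (n%ℕd<d a m)

≈-residue : ∀ m .{{_ : NonZero m}} a → a ≈ + toℕ (residue m a) [mod + m ]
≈-residue m a = mod (divides (a /ℕ m) (begin
  a - + toℕ (residue m a)                       ≡⟨ cong₂ (λ x y → x - + y) (a≡a%ℕn+[a/ℕn]*n a m) (toℕ-fromℕ< (n%ℕd<d a m)) ⟩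
  + (a %ℕ m) + (a /ℕ m) * + m - + (a %ℕ m)      ≡⟨ cancel (+ (a %ℕ m)) ((a /ℕ m) * + m) ⟩
  (a /ℕ m) * + m                                ∎))
  where
  open ≡-Reasoning
  cancel : ∀ x y → x + y - x ≡ y
  cancel = solve-∀

≋-residues : ∀ m .{{_ : NonZero m}} {n} (v : Vec ℤ n) → v ≋ ⌈ map (residue m) v ⌉ [mod + m ]
≋-residues m []      = []
≋-residues m (a ∷ v) = ≈-residue m a ∷ ≋-residues m v

-- Orbits of the Apollonian group

-- With `T` equal to `transpose N`, the vector under `map` is what `transpose (r ∷ N)` unfolds to.
-- Splitting off the contribution of the row `r` gives the inductive step of `transpose-·`.
transpose-∷-· : ∀ {m n} x (u : Vec ℤ m) (r : Vec ℤ n) (T : Vec (Vec ℤ m) n) v →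
  map ((x ∷ u) ·_) ((replicate n _∷_ Vec.⊛ r) Vec.⊛ T) · v ≡ x * (r · v) + map (u ·_) T · v
transpose-∷-· x u []      []      []      = sym (cong (_+ 0ℤ) (*-zeroʳ x))
transpose-∷-· x u (a ∷ r) (t ∷ T) (b ∷ v) = begin
  (x * a + u · t) * b + map ((x ∷ u) ·_) ((replicate _ _∷_ Vec.⊛ r) Vec.⊛ T) · v
    ≡⟨ cong (λ y → (x * a + u · t) * b + y) (transpose-∷-· x u r T v) ⟩
  (x * a + u · t) * b + (x * (r · v) + map (u ·_) T · v)
    ≡⟨ rearrange x a (u · t) b (r · v) (map (u ·_) T · v) ⟩
  x * (a * b + r · v) + ((u · t) * b + map (u ·_) T · v)  ∎
  where
  open ≡-Reasoning
  rearrange : ∀ x a y b p q → (x * a + y) * b + (x * p + q) ≡ x * (a * b + p) + (y * b + q)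
  rearrange = solve-∀

transpose-· : ∀ {m n} (u : Vec ℤ m) (N : Vec (Vec ℤ n) m) v →
  map (u ·_) (transpose N) · v ≡ u · map (_· v) N
transpose-· []      []      v = zeros v
  where
  zeros : ∀ {n} (v : Vec ℤ n) → map ([] ·_) (replicate n []) · v ≡ 0ℤ
  zeros []      = refl
  zeros (b ∷ v) = cong₂ _+_ (*-zeroˡ b) (zeros v)
transpose-· (x ∷ u) (r ∷ N) v =
  trans (transpose-∷-· x u r (transpose N) v) (cong (λ y → x * (r · v) + y) (transpose-· u N v))

⊛-∙ : ∀ {n} (M N : Matrix n) v → (M ⊛ N) ∙ v ≡ M ∙ N ∙ v
⊛-∙ M N v = trans (sym (map-∘ (_· v) _ M)) (map-cong (λ row → transpose-· row N v) M)

I-∙ : (v : Vec ℤ 4) → I ∙ v ≡ v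
I-∙ (a ∷ b ∷ c ∷ d ∷ []) =
  cong₂ _∷_ (e₀ a b c d) (cong₂ _∷_ (e₁ a b c d) (cong₂ _∷_ (e₂ a b c d) (cong (_∷ []) (e₃ a b c d))))
  where
  e₀ : ∀ a b c d → 1ℤ * a + (0ℤ * b + (0ℤ * c + (0ℤ * d + 0ℤ))) ≡ a
  e₀ = solve-∀
  e₁ : ∀ a b c d → 0ℤ * a + (1ℤ * b + (0ℤ * c + (0ℤ * d + 0ℤ))) ≡ b
  e₁ = solve-∀
  e₂ : ∀ a b c d → 0ℤ * a + (0ℤ * b + (1ℤ * c + (0ℤ * d + 0ℤ))) ≡ c
  e₂ = solve-∀
  e₃ : ∀ a b c d → 0ℤ * a + (0ℤ * b + (0ℤ * c + (1ℤ * d + 0ℤ))) ≡ d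
  e₃ = solve-∀

_⟶_ : Vec ℤ 4 → Vec ℤ 4 → Set
u ⟶ w = ∃[ i ] w ≡ S i ∙ u

⟶-sym : ∀ {u w} → u ⟶ w → w ⟶ u
⟶-sym {u} (i , refl) = i , sym (begin
  S i ∙ S i ∙ u    ≡⟨ ⊛-∙ (S i) (S i) u ⟨
  (S i ⊛ S i) ∙ u  ≡⟨ cong (_∙ u) (S-involutive i) ⟩
  I ∙ u            ≡⟨ I-∙ u ⟩
  u                ∎)
  where open ≡-Reasoning

-- Reduces group elements to single generators, so that invariants can be checked step by step.
-- Steps are reversible because generators are involutions; hence `inv` is handled by reading
-- backwards a path from `V ∙ v` to `U ∙ V ∙ v`, which is `v`.
𝒜⇒path : ∀ {U} → 𝒜 U → ∀ v → Star _⟶_ v (U ∙ v)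
𝒜⇒path (gen i)           v = (i , refl) ◅ ε
𝒜⇒path one               v = subst (Star _⟶_ v) (sym (I-∙ v)) ε
𝒜⇒path (mul {U} {V} p q) v =
  subst (Star _⟶_ v) (sym (⊛-∙ U V v)) (𝒜⇒path q v ◅◅ 𝒜⇒path p (V ∙ v))
𝒜⇒path (inv {U} {V} p (UV≡I , _)) v =
  reverse ⟶-sym (subst (Star _⟶_ (V ∙ v)) UVv≡v (𝒜⇒path p (V ∙ v)))
  where
  UVv≡v : U ∙ V ∙ v ≡ v
  UVv≡v = trans (sym (⊛-∙ U V v)) (trans (cong (_∙ v) UV≡I) (I-∙ v))

-- Each step preserves congruence to `ρ`: `S i ∙ u` is congruent to `S i ∙ ρ`, hence to `ρ`.
path-residues : ∀ {m ρ} → (∀ i → S i ∙ ρ ≋ ρ [mod m ]) →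
  ∀ {u w} → Star _⟶_ u w → u ≋ ρ [mod m ] → w ≋ ρ [mod m ]
path-residues fixed ε                 u≋ρ = u≋ρ
path-residues fixed ((i , refl) ◅ ps) u≋ρ =
  path-residues fixed ps (Pointwise.trans ≈-trans (∙-cong (S i) u≋ρ) (fixed i))

-- Finite checks modulo 3 and 4

∀Vec? : ∀ {m} n {P : Vec (Fin m) n → Set} → (∀ ρ → Dec (P ρ)) → Dec (∀ ρ → P ρ)
∀Vec? zero    P? = map′ (λ { p [] → p }) (λ p → p []) (P? [])
∀Vec? (suc n) P? =
  map′ (λ { p (a ∷ ρ) → p a ρ }) (λ p a ρ → p (a ∷ ρ)) (all? λ a → ∀Vec? n λ ρ → P? (a ∷ ρ))

abstract
  -- Modulo 3, `S i` replaces coordinate i by -σ. So coordinate i becomes the old coordinate k for j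
  -- = i ≠ k, becomes -σ for k = i ≠ j, and is unchanged for j = k. For a solution of the equation,
  -- the four coordinates together with -σ cover all residues.
  transitive-mod-3 : (ρ : Vec (Fin 3) 4) → Q𝒟 ⌈ ρ ⌉ ≈ - (+ 4) [mod + 3 ] →
    ∀ i (r : Fin 3) → ∃[ j ] ∃[ k ] lookup (S j ∙ S k ∙ ⌈ ρ ⌉) i ≈ + toℕ r [mod + 3 ]
  transitive-mod-3 = toWitness {a? = ∀Vec? 4 λ ρ → (Q𝒟 ⌈ ρ ⌉ ≈? - (+ 4) [mod + 3 ]) →-dec
    all? λ i → all? λ r → any? λ j → any? λ k → lookup (S j ∙ S k ∙ ⌈ ρ ⌉) i ≈? + toℕ r [mod + 3 ]} _

abstract
  -- `S i` changes aᵢ by 2σ - 4aᵢ, so the invariance follows from the parity of σ.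
  fixed-mod-4 : (ρ : Vec (Fin 4) 4) → Q𝒟 ⌈ ρ ⌉ ≈ - (+ 4) [mod + 8 ] →
    + 2 ∣ ∑ ⌈ ρ ⌉ × (∀ i → S i ∙ ⌈ ρ ⌉ ≋ ⌈ ρ ⌉ [mod + 4 ])
  fixed-mod-4 = toWitness {a? = ∀Vec? 4 λ ρ → (Q𝒟 ⌈ ρ ⌉ ≈? - (+ 4) [mod + 8 ]) →-dec
    ((+ 2 ∣? ∑ ⌈ ρ ⌉) ×-dec all? λ i → Pointwise.decidable (λ a b → a ≈? b [mod + 4 ]) (S i ∙ ⌈ ρ ⌉) ⌈ ρ ⌉)} _

occurs-mod-4? : (ρ : Vec (Fin 4) 4) (r : Fin 12) → Dec (∃[ i ] lookup ⌈ ρ ⌉ i ≈ + toℕ r [mod + 4 ])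
occurs-mod-4? ρ r = any? λ i → lookup ⌈ ρ ⌉ i ≈? + toℕ r [mod + 4 ]

-- The prospective answer: the classes modulo 12 lying over the residues in `ρ`, tabulated so that
-- the complement can be counted by evaluation.
classes : Vec (Fin 4) 4 → Subset 12
classes ρ = tabulate λ r → does (occurs-mod-4? ρ r)

abstract
  -- One class modulo 4 is missing, and it has three lifts modulo 12. Modulus 8 would be too coarse:
  -- (0, 0, 0, 2) has `Q𝒟` equal to 4, congruent to -4 modulo 8, but meets only two classes modulo
  -- 4.
  three-classes-omitted : (ρ : Vec (Fin 4) 4) → Q𝒟 ⌈ ρ ⌉ ≈ - (+ 4) [mod + 16 ] → ∣ ∁ (classes ρ) ∣ ≡ 3
  three-classes-omitted = toWitness {a? = ∀Vec? 4 λ ρ →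
    (Q𝒟 ⌈ ρ ⌉ ≈? - (+ 4) [mod + 16 ]) →-dec (∣ ∁ (classes ρ) ∣ ℕ.≟ 3)} _

does-true : ∀ {P : Set} (P? : Dec P) → does P? ≡ true → P
does-true (yes p) _ = p

∈-classes : ∀ ρ r → r ∈ classes ρ ⇔ (∃[ i ] lookup ⌈ ρ ⌉ i ≈ + toℕ r [mod + 4 ])
∈-classes ρ r = mk⇔
  (λ r∈ → does-true (occurs-mod-4? ρ r) (trans (sym classes-at-r) ([]=⇒lookup r∈)))
  (λ occ → lookup⇒[]= r (classes ρ) (trans classes-at-r (dec-true (occurs-mod-4? ρ r) occ)))
  where
  classes-at-r : lookup (classes ρ) r ≡ does (occurs-mod-4? ρ r)
  classes-at-r = lookup∘tabulate (λ r → does (occurs-mod-4? ρ r)) r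

-- Curvatures modulo 3 and modulo 12

∙∙-cong : ∀ {m} j k {u v} → u ≋ v [mod m ] → S j ∙ S k ∙ u ≋ S j ∙ S k ∙ v [mod m ]
∙∙-cong j k u≋v = ∙-cong (S j) (∙-cong (S k) u≋v)

Q𝒟-residues : ∀ {m m′} .{{_ : NonZero m}} v → Q𝒟 v ≡ - (+ 4) →
  Q𝒟 v ≈ Q𝒟 ⌈ map (residue m) v ⌉ [mod m′ ] → Q𝒟 ⌈ map (residue m) v ⌉ ≈ - (+ 4) [mod m′ ]
Q𝒟-residues {m} v = ≈-flip-≡ {a = Q𝒟 v} {b = Q𝒟 ⌈ map (residue m) v ⌉}

orbit-hits-mod-3 : ∀ v → Q𝒟 v ≡ - (+ 4) → ∀ i c →
  ∃[ w ] (𝒜[ v ] w × lookup w i ≈ c [mod + 3 ])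
orbit-hits-mod-3 v Q≡-4 i c =
  let ρ = map (residue 3) v
      j , k , hit = transitive-mod-3 ρ (Q𝒟-residues {3} v Q≡-4 (Q𝒟-cong {u = v} {⌈ ρ ⌉} (≋-residues 3 v))) i (residue 3 c)
  in S j ∙ S k ∙ v
   , (S j ⊛ S k , mul (gen j) (gen k) , sym (⊛-∙ (S j) (S k) v))
   , ≈-trans (Pointwise.lookup (∙∙-cong j k {v} {⌈ ρ ⌉} (≋-residues 3 v)) i) (≈-trans hit (≈-sym (≈-residue 3 c)))

theorem5p1 : (v : Vec ℤ 4) → Q𝒟 v ≡ - (+ 4) →
    Σ[ R ∈ Subset 12 ] ((∀ r → r ∈ R ⇔ ResidueOf 12 (Curvature v) r) × ∣ ∁ R ∣ ≡ 3)
theorem5p1 v Q≡-4 = classes ρ , (λ r → mk⇔ (attained r) (admissible r)) ,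
  -- The equation modulo 8 first yields an even coordinate sum; that parity then permits reading it
  -- modulo 16.
  three-classes-omitted ρ (Q𝒟-residues {4} v Q≡-4 (Q𝒟-cong-16 {v} {⌈ ρ ⌉} (proj₁ ρ-fixed) v≋ρ))
  where
  ρ : Vec (Fin 4) 4
  ρ = map (residue 4) v

  v≋ρ : v ≋ ⌈ ρ ⌉ [mod + 4 ]
  v≋ρ = ≋-residues 4 v

  ρ-fixed : + 2 ∣ ∑ ⌈ ρ ⌉ × (∀ i → S i ∙ ⌈ ρ ⌉ ≋ ⌈ ρ ⌉ [mod + 4 ])
  ρ-fixed = fixed-mod-4 ρ (Q𝒟-residues {4} v Q≡-4 (Q𝒟-cong-8 {v} {⌈ ρ ⌉} v≋ρ))

  orbit≋ρ : ∀ {w} → 𝒜[ v ] w → w ≋ ⌈ ρ ⌉ [mod + 4 ]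
  orbit≋ρ (U , U∈𝒜 , refl) = path-residues (proj₂ ρ-fixed) (𝒜⇒path U∈𝒜 v) v≋ρ

  attained : ∀ r → r ∈ classes ρ → ResidueOf 12 (Curvature v) r
  attained r r∈ =
    let i , ρᵢ≈r       = to (∈-classes ρ r) r∈
        -- Coordinate i can be moved to the residue of r modulo 3 without disturbing it modulo 4,
        -- where the orbit is constant.
        w , w∈ , wᵢ≈r  = orbit-hits-mod-3 v Q≡-4 i (+ toℕ r)
    in lookup w i , (w , w∈ , i , refl) ,
       difference (≈-chinese-12 wᵢ≈r (≈-trans (Pointwise.lookup (orbit≋ρ w∈) i) ρᵢ≈r))

  admissible : ∀ r → ResidueOf 12 (Curvature v) r → r ∈ classes ρ
  admissible r (_ , (w , w∈ , i , refl) , 12∣) = from (∈-classes ρ r)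
    (i , ≈-trans (≈-sym (Pointwise.lookup (orbit≋ρ w∈) i)) (≈-coarsen (divides (+ 3) refl) (mod 12∣)))
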